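{- Let $G_0,G_1\in\mathbb{Z}$, let $(G_n)_{n\ge0}$ satisfy $G_n=G_{n-1}+G_{n-2}$ for $n\ge2$, and let $\mu = G_1^2 - G_0 G_1 - G_0^2$. For every odd integer $k \geq 1$, $\mathcal{G}^2_{G_0,G_1}(k)$ divides $|2\mu|$.
   Context: $\mathcal{G}^2_{G_0,G_1}(k)=\gcd\{\sum_{i=1}^k G_{n+i}^2 : n\ge 0\}$ (nonnegative gcd of this infinite set of integers). -}

module Defs where

import Algebra.Properties.Semiring.Sum as Sum
open import Data.Fin.Base using (Fin; zero; suc; toℕ)
open import Data.Integer.Base using (ℤ; +_; _+_; _-_; _*_; ∣_∣; _^_)
import Data.Integer.Divisibility.Signed as Signed
open import Data.Integer.Properties using (+-*-semiring)
open import Data.Integer.Tactic.RingSolver using (solve-∀)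
open import Data.Nat.Base as ℕ using (ℕ; zero; suc)
open import Data.Nat.Divisibility using (_∣_; ∣-trans; ∣-antisym)
open import Data.Nat.GCD using (gcd; gcd[m,n]∣m; gcd[m,n]∣n; gcd-greatest)
open import Data.Product.Base using (∃-syntax; _,_; proj₁; proj₂)
open import Data.Vec.Functional using (Vector)
open import Relation.Binary.PropositionalEquality
  using (_≡_; refl; sym; trans; cong; cong₂; subst)

open Sum +-*-semiring using (sum; sum-syntax)

gibonacci : ℤ → ℤ → ℕ → ℤ
gibonacci G₀ G₁ zero          = G₀
gibonacci G₀ G₁ (suc zero)    = G₁
gibonacci G₀ G₁ (suc (suc n)) = gibonacci G₀ G₁ (suc n) + gibonacci G₀ G₁ n

μ : ℤ → ℤ → ℤ
μ G₀ G₁ = G₁ ^ 2 - G₀ * G₁ - G₀ ^ 2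

-- The index i of the library sum runs over 0, …, k - 1, so it is shifted by
-- one to give G (n + 1) ² + … + G (n + k) ².
sumSquares : ℤ → ℤ → ℕ → ℕ → ℤ
sumSquares G₀ G₁ k n = ∑[ i < k ] (gibonacci G₀ G₁ (n ℕ.+ suc (toℕ i)) ^ 2)

-- g is the nonnegative gcd of the set of integers { a n : n ≥ 0 }.  As for
-- the gcd of two numbers, "greatest" refers to the divisibility order, so
-- that the gcd of { 0 } is 0.
record IsGCD (a : ℕ → ℤ) (g : ℕ) : Set where
  field
    divides  : ∀ n → g ∣ ∣ a n ∣
    greatest : ∀ {d} → (∀ n → d ∣ ∣ a n ∣) → d ∣ g

IsGCD-unique : ∀ {a g h} → IsGCD a g → IsGCD a h → g ≡ h
IsGCD-unique p q =
  ∣-antisym (IsGCD.greatest q (IsGCD.divides p)) (IsGCD.greatest p (IsGCD.divides q))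

-- The gcd of an arbitrary sequence of integers need not be computable.  Here
-- the sums satisfy a linear recurrence of order 3, so it exists constructively.
private
  step : ℤ → ℤ → ℤ → ℤ
  step x y z = + 2 * (z + y) - x

  square-step : ∀ x y → (y + x + y) ^ 2 ≡ step (x ^ 2) (y ^ 2) ((y + x) ^ 2)
  square-step = expanded
    where
    expanded : ∀ x y →
      (y + x + y) * ((y + x + y) * + 1) ≡
      + 2 * ((y + x) * ((y + x) * + 1) + y * (y * + 1)) - x * (x * + 1)
    expanded = solve-∀

  sum-step : ∀ k (a b c d : Vector ℤ k) →
             (∀ i → d i ≡ step (a i) (b i) (c i)) →
             sum d ≡ step (sum a) (sum b) (sum c)
  sum-step zero    a b c d eq = refl
  sum-step (suc k) a b c d eq = trans
    (cong₂ _+_ (eq zero)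
      (sum-step k (λ i → a (suc i)) (λ i → b (suc i)) (λ i → c (suc i)) (λ i → d (suc i))
        (λ i → eq (suc i))))
    (rearrange (a zero) (b zero) (c zero) _ _ _)
    where
    rearrange : ∀ x y z x′ y′ z′ →
      + 2 * (z + y) - x + (+ 2 * (z′ + y′) - x′) ≡
      + 2 * (z + z′ + (y + y′)) - (x + x′)
    rearrange = solve-∀

  ∣-step : ∀ {d} x y z → d ∣ ∣ x ∣ → d ∣ ∣ y ∣ → d ∣ ∣ z ∣ → d ∣ ∣ step x y z ∣
  ∣-step {d} x y z d∣x d∣y d∣z = Signed.∣⇒∣ᵤ {+ d}
    (Signed.∣m∣n⇒∣m-n
      (Signed.∣n⇒∣m*n (+ 2) (Signed.∣m∣n⇒∣m+n (Signed.∣ᵤ⇒∣ {+ d} {z} d∣z) (Signed.∣ᵤ⇒∣ {+ d} {y} d∣y)))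
      (Signed.∣ᵤ⇒∣ {+ d} {x} d∣x))

  recurrence⇒gcd : (a : ℕ → ℤ) →
    (∀ n → a (3 ℕ.+ n) ≡ step (a n) (a (1 ℕ.+ n)) (a (2 ℕ.+ n))) →
    ∃[ g ] IsGCD a g
  recurrence⇒gcd a rec = g , record
    { divides  = g∣a
    ; greatest = λ d∣a → gcd-greatest (d∣a 0) (gcd-greatest (d∣a 1) (d∣a 2))
    }
    where
    h = gcd ∣ a 1 ∣ ∣ a 2 ∣
    g = gcd ∣ a 0 ∣ h

    g∣h : g ∣ h
    g∣h = gcd[m,n]∣n ∣ a 0 ∣ h

    g∣a : ∀ n → g ∣ ∣ a n ∣
    g∣a 0 = gcd[m,n]∣m ∣ a 0 ∣ h
    g∣a 1 = ∣-trans g∣h (gcd[m,n]∣m ∣ a 1 ∣ ∣ a 2 ∣)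
    g∣a 2 = ∣-trans g∣h (gcd[m,n]∣n ∣ a 1 ∣ ∣ a 2 ∣)
    g∣a (suc (suc (suc n))) = subst (λ x → g ∣ ∣ x ∣) (sym (rec n))
      (∣-step (a n) (a (1 ℕ.+ n)) (a (2 ℕ.+ n)) (g∣a n) (g∣a (suc n)) (g∣a (suc (suc n))))

sumSquares-gcd : ∀ G₀ G₁ k → ∃[ g ] IsGCD (sumSquares G₀ G₁ k) g
sumSquares-gcd G₀ G₁ k = recurrence⇒gcd (sumSquares G₀ G₁ k) λ n →
  sum-step k _ _ _ _ λ i →
    square-step (gibonacci G₀ G₁ (n ℕ.+ suc (toℕ i))) (gibonacci G₀ G₁ (suc (n ℕ.+ suc (toℕ i))))

𝒢² : ℤ → ℤ → ℕ → ℕ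
𝒢² G₀ G₁ k = proj₁ (sumSquares-gcd G₀ G₁ k)

𝒢²-isGCD : ∀ G₀ G₁ k → IsGCD (sumSquares G₀ G₁ k) (𝒢² G₀ G₁ k)
𝒢²-isGCD G₀ G₁ k = proj₂ (sumSquares-gcd G₀ G₁ k)

-- The combination S(2) - 3 S(1) + S(0) of the sums S(n) = ∑ᵢ G (n + i) ² is a
-- multiple of the gcd.  It is the sum over i = 1, …, k of
-- G (i + 2) ² - 3 G (i + 1) ² + G i ², which equals 2 (-1) ^ (i + 1) μ by
-- Cassini's identity, so for odd k all but one of the terms ± 2 μ cancel.
{-# OPTIONS --safe #-}
module Submission where

open import Defs
open import Algebra.Properties.Semiring.Sum using (sum)
open import Data.Fin.Base using (zero; suc; toℕ)
open import Data.Integer.Base using (ℤ; +_; -_; _+_; _-_; _*_; _^_; ∣_∣)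
import Data.Integer.Divisibility.Signed as Signed
open import Data.Integer.Properties using (+-*-semiring; +-identityʳ; neg-involutive)
open import Data.Integer.Tactic.RingSolver using (solve-∀)
open import Data.Nat.Base as ℕ using (ℕ; zero; suc; _≤_; parity)
open import Data.Nat.Divisibility using (_∣_)
open import Data.Parity.Base using (1ℙ)
open import Data.Vec.Functional using (Vector)
open import Relation.Binary.PropositionalEquality
  using (_≡_; refl; trans; cong; cong₂; subst)

private
  ∑ : ∀ {k} → Vector ℤ k → ℤ
  ∑ = sum +-*-semiring

combination : ℤ → ℤ → ℤ → ℤ
combination x y z = z - + 3 * y + x

∑-combination : ∀ k (a b c : Vector ℤ k) →
  combination (∑ a) (∑ b) (∑ c) ≡ ∑ (λ i → combination (a i) (b i) (c i))
∑-combination zero    a b c = refl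
∑-combination (suc k) a b c = trans
  (rearrange (a zero) (b zero) (c zero) _ _ _)
  (cong (_+_ (combination (a zero) (b zero) (c zero)))
    (∑-combination k (λ i → a (suc i)) (λ i → b (suc i)) (λ i → c (suc i))))
  where
  rearrange : ∀ x y z x′ y′ z′ →
    z + z′ - + 3 * (y + y′) + (x + x′) ≡
    z - + 3 * y + x + (z′ - + 3 * y′ + x′)
  rearrange = solve-∀

-- Induction in steps of two, since `parity (suc (suc k))` computes to `parity k`. The tail from
-- index 2 sums to `f 2`, which equals `f 0` and cancels against `f 1`.
∑-alternating : (f : ℕ → ℤ) → (∀ i → f (suc i) ≡ - f i) →
  ∀ k → parity k ≡ 1ℙ → ∑ {k} (λ i → f (toℕ i)) ≡ f 0
∑-alternating f alt (suc zero)    odd = +-identityʳ (f 0)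
∑-alternating f alt (suc (suc k)) odd = trans
  (cong₂ (λ x y → f 0 + (x + y)) (alt 0)
    (trans (∑-alternating (λ i → f (suc (suc i))) (λ i → alt (suc (suc i))) k odd)
      f₂≡f₀))
  (cancel (f 0))
  where
  f₂≡f₀ : f 2 ≡ f 0
  f₂≡f₀ = trans (alt 1) (trans (cong -_ (alt 0)) (neg-involutive (f 0)))

  cancel : ∀ x → x + (- x + x) ≡ x
  cancel = solve-∀

-- Absolute values are not additive, so the argument passes through signed divisibility, which
-- respects linear combinations.
∣-combination : ∀ {d} x y z → d ∣ ∣ x ∣ → d ∣ ∣ y ∣ → d ∣ ∣ z ∣ →
  d ∣ ∣ combination x y z ∣
∣-combination {d} x y z d∣x d∣y d∣z = Signed.∣⇒∣ᵤ {+ d}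
  (Signed.∣m∣n⇒∣m+n
    (Signed.∣m∣n⇒∣m-n (Signed.∣ᵤ⇒∣ {+ d} {z} d∣z)
      (Signed.∣n⇒∣m*n (+ 3) (Signed.∣ᵤ⇒∣ {+ d} {y} d∣y)))
    (Signed.∣ᵤ⇒∣ {+ d} {x} d∣x))

module _ (G₀ G₁ : ℤ) where

  private
    G : ℕ → ℤ
    G = gibonacci G₀ G₁

    S : ℕ → ℕ → ℤ
    S = sumSquares G₀ G₁

  squareCombination : ℕ → ℤ
  squareCombination i = combination (G (suc i) ^ 2) (G (2 ℕ.+ i) ^ 2) (G (3 ℕ.+ i) ^ 2)

  -- With `x = G (i + 1)` and `y = G (i + 2)` the combination is -2 (y² - x y - x²). This quadratic
  -- form is `μ x y`, and it changes sign under the shift from (x, y) to (y, y + x).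
  squareCombination-alternates : ∀ i → squareCombination (suc i) ≡ - squareCombination i
  squareCombination-alternates i = expanded (G (suc i)) (G (suc (suc i)))
    where
    -- The ring solver does not support _^_, so x ^ 2 is unfolded to x * (x * + 1).
    expanded : ∀ x y →
      (y + x + y) * ((y + x + y) * + 1) - + 3 * ((y + x) * ((y + x) * + 1)) + y * (y * + 1) ≡
      - ((y + x) * ((y + x) * + 1) - + 3 * (y * (y * + 1)) + x * (x * + 1))
    expanded = solve-∀

  -- The value is -2 times the form `μ` at (`G 1`, `G 2`); shifting back to (`G 0`, `G 1`) removes
  -- the sign.
  squareCombination-zero : squareCombination 0 ≡ + 2 * μ G₀ G₁
  squareCombination-zero = expanded G₀ G₁
    where
    expanded : ∀ q p →
      (p + q + p) * ((p + q + p) * + 1) - + 3 * ((p + q) * ((p + q) * + 1)) + p * (p * + 1) ≡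
      + 2 * (p * (p * + 1) - q * p - q * (q * + 1))
    expanded = solve-∀

  sumSquares-combination : ∀ k → parity k ≡ 1ℙ →
    combination (S k 0) (S k 1) (S k 2) ≡ + 2 * μ G₀ G₁
  sumSquares-combination k odd = trans (∑-combination k _ _ _)
    (trans (∑-alternating squareCombination squareCombination-alternates k odd)
      squareCombination-zero)

theorem4p8 : (G₀ G₁ : ℤ) (k : ℕ) → 1 ≤ k → parity k ≡ 1ℙ →
    𝒢² G₀ G₁ k ∣ ∣ + 2 * μ G₀ G₁ ∣
theorem4p8 G₀ G₁ k _ odd = subst (λ x → 𝒢² G₀ G₁ k ∣ ∣ x ∣)
  (sumSquares-combination G₀ G₁ k odd)
  (∣-combination (S 0) (S 1) (S 2) (divides 0) (divides 1) (divides 2))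
  where
  S = sumSquares G₀ G₁ k
  open IsGCD (𝒢²-isGCD G₀ G₁ k) using (divides)
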